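{- Let $\Gamma$ be a graph of connectivity $1$. Then $\Gamma$ is arc-transitive if and only if: (1) every lobe of $\Gamma$ is arc-transitive; (2) the lobes of $\Gamma$ are pairwise isomorphic; and (3) all vertices of $\Gamma$ lie in the same number of lobes.
   Context: All graphs are simple, connected, and finite or countably infinite. For edges $e_1,e_2$ write $e_1\cong e_2$ if $e_1=e_2$ or they lie on a common cycle; a lobe is the subgraph induced by an equivalence class (a cut-edge with its ends, or a maximal biconnected subgraph). A connected graph other than $K_2$ has connectivity $1$ iff some vertex lies in at least two lobes. An arc is an ordered pair of adjacent vertices; arc-transitive means the automorphism group acts transitively on arcs. -}

module Defs where

open import Level using (0ℓ)
open import Data.Nat.Base using (ℕ; suc; _+_)
open import Data.Nat.DivMod using (_mod_)
open import Data.Fin.Base using (Fin; toℕ)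
open import Data.Product.Base using (Σ; Σ-syntax; ∃; ∃-syntax; _×_; _,_; proj₁; swap)
open import Data.Sum.Base using (_⊎_; inj₁; inj₂)
import Data.Sum.Base as Sum
open import Data.Refinement using (Refinement; Refinement-syntax; value)
open import Function.Base using (_on_)
open import Function.Bundles using (_↔_; _↣_; _⇔_; Inverse)
open import Function.Construct.Identity using (⇔-id)
open import Function.Construct.Symmetry using (⇔-sym)
open import Function.Construct.Composition using (_⇔-∘_)
open import Function.Definitions using (Injective)
open import Relation.Binary.Bundles using (Setoid)
open import Relation.Binary.Core using (Rel)
open import Relation.Binary.Definitions using (Symmetric; Irreflexive)
open import Relation.Binary.Construct.Closure.ReflexiveTransitive using (Star)
open import Relation.Binary.PropositionalEquality using (_≡_; _≢_; refl; ≢-sym)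
open import Relation.Nullary.Negation using (¬_)

record Graph : Set₁ where
  field
    V      : Set
    Adj    : Rel V 0ℓ
    sym    : Symmetric Adj
    irrefl : Irreflexive _≡_ Adj

open Graph

Connected : Graph → Set
Connected Γ = ∀ u v → Star (Adj Γ) u v

-- Finite or countably infinite.
Countable : Graph → Set
Countable Γ = V Γ ↣ ℕ

K : ℕ → Graph
K n = record { V = Fin n ; Adj = _≢_ ; sym = ≢-sym ; irrefl = λ p q → q p }

infix 4 _≃_

record _≃_ (Γ Δ : Graph) : Set where
  field
    bijection : V Γ ↔ V Δ

  open Inverse bijection public using (to; from)

  field
    adj⇔adj : ∀ u v → Adj Γ u v ⇔ Adj Δ (to u) (to v)

Automorphism : Graph → Set
Automorphism Γ = Γ ≃ Γ

record Arc (Γ : Graph) : Set where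
  constructor arc
  field
    tail head : V Γ
    adjacent  : Adj Γ tail head

open Arc

ArcTransitive : Graph → Set
ArcTransitive Γ = ∀ (a b : Arc Γ) → Σ[ φ ∈ Automorphism Γ ]
  (_≃_.to φ (tail a) ≡ tail b × _≃_.to φ (head a) ≡ head b)

-- The cyclic successor i ↦ i + 1 (mod n).
next : ∀ {n} → Fin (suc n) → Fin (suc n)
next {n} i = suc (toℕ i) mod suc n

module _ (Γ : Graph) where

  -- An edge {u , v} is represented by either of the arcs (u , v), (v , u);
  -- equality of edges is therefore SameEdge, not _≡_.
  SameEdge : Rel (Arc Γ) 0ℓ
  SameEdge e f = (tail e ≡ tail f × head e ≡ head f)
               ⊎ (tail e ≡ head f × head e ≡ tail f)

  Incident : V Γ → Arc Γ → Set
  Incident v e = v ≡ tail e ⊎ v ≡ head e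

  record Cycle : Set where
    field
      excess   : ℕ

    length : ℕ
    length = 3 + excess

    field
      vertex   : Fin length → V Γ
      distinct : Injective _≡_ _≡_ vertex
      linked   : ∀ i → Adj Γ (vertex i) (vertex (next i))

    edge : Fin length → Arc Γ
    edge i = arc (vertex i) (vertex (next i)) (linked i)

  LiesOn : Arc Γ → Cycle → Set
  LiesOn e C = ∃[ i ] SameEdge e (Cycle.edge C i)

  infix 4 _≅_

  _≅_ : Rel (Arc Γ) 0ℓ
  e ≅ f = SameEdge e f ⊎ (Σ[ C ∈ Cycle ] (LiesOn e C × LiesOn f C))

  reverse : Arc Γ → Arc Γ
  reverse (arc u v a) = arc v u (sym Γ a)

  reverse-SameEdge : ∀ e f → SameEdge e f → SameEdge (reverse e) f
  reverse-SameEdge _ _ (inj₁ p) = inj₂ (swap p)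
  reverse-SameEdge _ _ (inj₂ p) = inj₁ (swap p)

  reverse-≅ : ∀ e f → e ≅ f → reverse e ≅ f
  reverse-≅ e f (inj₁ p) = inj₁ (reverse-SameEdge e f p)
  reverse-≅ e f (inj₂ (C , (i , p) , q)) =
    inj₂ (C , (i , reverse-SameEdge e (Cycle.edge C i) p) , q)

  infix 4 _∈lobe_

  _∈lobe_ : V Γ → Arc Γ → Set
  v ∈lobe e = ∃[ f ] (f ≅ e × Incident v f)

  -- The lobe containing the edge e: the subgraph whose edges are the class of e
  -- and whose vertices are their ends. Membership in the vertex set is
  -- proof-irrelevant, so that each vertex of Γ occurs at most once.
  lobe : Arc Γ → Graph
  lobe e = record
    { V      = [ v ∈ V Γ ∣ v ∈lobe e ]
    ; Adj    = AdjIn on value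
    ; sym    = λ (a , p) → sym Γ a , reverse-≅ (arc _ _ a) e p
    ; irrefl = λ { refl (a , _) → irrefl Γ refl a }
    }
    where
    AdjIn : Rel (V Γ) 0ℓ
    AdjIn u v = Σ[ a ∈ Adj Γ u v ] (arc u v a ≅ e)

  -- Equality of the classes of e and f, as sets of edges.
  SameLobe : Rel (Arc Γ) 0ℓ
  SameLobe e f = ∀ g → g ≅ e ⇔ g ≅ f

  -- The set of lobes containing v, each given by any of its edges.
  LobesAt : V Γ → Setoid 0ℓ 0ℓ
  LobesAt v = record
    { Carrier       = Σ[ e ∈ Arc Γ ] v ∈lobe e
    ; _≈_           = SameLobe on proj₁
    ; isEquivalence = record
      { refl  = λ g → ⇔-id _
      ; sym   = λ p g → ⇔-sym (p g)
      ; trans = λ p q g → q g ⇔-∘ p g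
      }
    }

  -- Equality of cardinals: a bijection between the two sets of lobes.
  SameNumberOfLobes : Rel (V Γ) 0ℓ
  SameNumberOfLobes u v = Inverse (LobesAt u) (LobesAt v)

  InTwoLobes : V Γ → Set
  InTwoLobes v = ∃[ L ] ∃[ M ] ¬ Setoid._≈_ (LobesAt v) L M

  -- K 2 has connectivity 1 although neither of its vertices lies in two lobes.
  ConnectivityOne : Set
  ConnectivityOne = Connected Γ × (Γ ≃ K 2 ⊎ ∃ InTwoLobes)

{-# OPTIONS --safe #-}

-- Two edges are in the same lobe iff two disjoint walks link the ends of one to
-- the ends of the other; in this form the relation is seen to be transitive. Root
-- Γ at a vertex. Every lobe L has a vertex t nearest to the root, its top, and L
-- is the lobe through which each other vertex of L is joined to the root; so the
-- lobes form a tree. Given arcs a and b, root the domain at the tail of a and the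
-- codomain at the tail of b. An automorphism taking a to b is built down the tree:
-- when the top t of L has been sent to s, a bijection from the lobes at t to those
-- at s, matching the lobes towards the roots, selects a lobe M at s, and an
-- isomorphism L ≃ M taking t to s extends the map to L. The same data read
-- backwards give the inverse map.
module Submission where

open import Defs
open import Level using (0ℓ)
open import Axiom.ExcludedMiddle using (ExcludedMiddle)
open import Data.Fin.Base using (Fin; zero; suc; toℕ; fromℕ; inject₁)
open import Data.Fin.Induction using (<-weakInduction; >-weakInduction)
open import Data.Fin.Properties using (toℕ-fromℕ; toℕ-fromℕ<; toℕ-inject₁; toℕ-injective; toℕ<n)
open import Data.Fin.Relation.Unary.Top using (view; ‵fromℕ; ‵inject₁)
open import Data.Irrelevant using ([_])
open import Data.List.Base using (List; []; _∷_; _++_; length; lookup)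
open import Data.List.Membership.Propositional using (_∈_; _∉_)
open import Data.List.Membership.Propositional.Properties using (∈-lookup)
open import Data.List.Relation.Unary.All as All using (All; []; _∷_)
open import Data.List.Relation.Unary.All.Properties using (¬Any⇒All¬; All¬⇒¬Any)
open import Data.List.Relation.Unary.AllPairs using ([]; _∷_)
open import Data.List.Relation.Unary.Any using (here; there)
open import Data.List.Relation.Unary.Unique.Propositional using (Unique)
open import Data.List.Relation.Unary.Unique.Propositional.Properties using (++⁺)
open import Data.Nat.Base using (ℕ; suc; _≤_; _<_; s≤s)
open import Data.Nat.DivMod using (_%_; m<n⇒m%n≡m; n%n≡0)
open import Data.Nat.Induction using (<-wellFounded)
open import Data.Nat.Properties
  using (≤-refl; ≤-trans; ≤-reflexive; ≤-antisym; ≮⇒≥; n≤1+n; <-irrefl)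
open import Data.Product.Base using (Σ-syntax; ∃; ∃-syntax; _×_; _,_; proj₁; proj₂)
open import Data.Refinement using (Refinement; Refinement-syntax; value; value-injective; _,_)
import Data.Refinement as Refinement
open import Data.Sum.Base as Sum using (_⊎_; inj₁; inj₂)
open import Function.Base using (_∘_; _$_)
open import Function.Bundles using (_↔_; _⇔_; Inverse; Injection; Equivalence; mk↔ₛ′; mk⇔)
open import Function.Construct.Composition using (_↔-∘_; _⇔-∘_)
open import Function.Construct.Symmetry using (↔-sym)
import Function.Construct.Symmetry as Symmetry
open import Function.Definitions using (Injective)
open import Function.Properties.Inverse using (Inverse⇒Injection)
open import Induction.WellFounded using (Acc; acc)
open import Relation.Binary.Construct.Closure.ReflexiveTransitive using (Star; ε; _◅_)
open import Relation.Binary.PropositionalEquality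
  using (_≡_; _≢_; refl; sym; trans; cong; subst; subst₂; ≢-sym)
open import Relation.Nullary.Decidable.Core using (yes; no; recompute)
open import Relation.Nullary.Negation using (¬_; contradiction)

open Graph using (V; Adj)
open Arc
open _≃_ using (to; from; bijection; adj⇔adj)

-- Indexing: the cyclic successor and lookups in lists.

next-fromℕ : ∀ n → next (fromℕ n) ≡ zero
next-fromℕ n = toℕ-injective $
  trans (toℕ-fromℕ< _) (trans (cong (λ m → suc m % suc n) (toℕ-fromℕ n)) (n%n≡0 (suc n)))

next-inject₁ : ∀ {n} (i : Fin n) → next (inject₁ i) ≡ suc i
next-inject₁ {n} i = toℕ-injective $
  trans (toℕ-fromℕ< _) (trans (cong (λ m → suc m % suc n) (toℕ-inject₁ i))
    (m<n⇒m%n≡m (s≤s (toℕ<n i))))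

lookup-injective : {A : Set} {xs : List A} → Unique xs → Injective _≡_ _≡_ (lookup xs)
lookup-injective (x∉ ∷ _) {zero} {zero} _ = refl
lookup-injective (x∉ ∷ _) {zero} {suc j} p = contradiction p (All.lookup x∉ (∈-lookup j))
lookup-injective (x∉ ∷ _) {suc i} {zero} p = contradiction (sym p) (All.lookup x∉ (∈-lookup i))
lookup-injective (_ ∷ u) {suc i} {suc j} p = cong suc (lookup-injective u p)

-- Walks inside a set of vertices.

module Walks (em : ExcludedMiddle 0ℓ) (Γ : Graph) where

  private
    variable
      S T : V Γ → Set
      a b p q u v w x y z : V Γ
      xs ys : List (V Γ)

  infixr 5 _∷⟨_⟩_ _◅◅_

  data Walk (S : V Γ → Set) : V Γ → V Γ → Set where
    [_]    : S u → Walk S u u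
    _∷⟨_⟩_ : S u → Adj Γ u w → Walk S w v → Walk S u v

  source : Walk S u v → S u
  source [ s ]         = s
  source (s ∷⟨ _ ⟩ _) = s

  target : Walk S u v → S v
  target [ s ]         = s
  target (_ ∷⟨ _ ⟩ W) = target W

  map : (∀ {w} → S w → T w) → Walk S u v → Walk T u v
  map f [ s ]          = [ f s ]
  map f (s ∷⟨ a ⟩ W) = f s ∷⟨ a ⟩ map f W

  _◅◅_ : Walk S u v → Walk S v w → Walk S u w
  [ _ ]          ◅◅ W′ = W′
  (s ∷⟨ a ⟩ W) ◅◅ W′ = s ∷⟨ a ⟩ (W ◅◅ W′)

  _▻⟨_⟩_ : Walk S u v → Adj Γ v w → Walk S w x → Walk S u x
  W ▻⟨ a ⟩ W′ = W ◅◅ (target W ∷⟨ a ⟩ W′)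

  reverseʷ : Walk S u v → Walk S v u
  reverseʷ [ s ]          = [ s ]
  reverseʷ (s ∷⟨ a ⟩ W) = reverseʷ W ▻⟨ Graph.sym Γ a ⟩ [ s ]

  -- Replaces `S` by the component of `u` in `S`, the form of the sets that `pivot` assembles.
  reachable : Walk S u v → Walk (Walk S u) u v
  reachable [ s ]          = [ [ s ] ]
  reachable (s ∷⟨ a ⟩ W) = [ s ] ∷⟨ a ⟩ map (s ∷⟨ a ⟩_) (reachable W)

  firstHit : (T : V Γ → Set) → Walk S u v → T v →
             ∃[ z ] T z × Walk (λ w → S w × (T w → w ≡ z)) u z
  firstHit T [ s ] t = _ , t , [ s , (λ _ → refl) ]
  firstHit {u = u} T (s ∷⟨ a ⟩ W) t with em {T u}
  ... | yes tu = u , tu , [ s , (λ _ → refl) ]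
  ... | no ¬tu = let z , tz , W′ = firstHit T W t in
                 z , tz , (s , λ tu → contradiction tu ¬tu) ∷⟨ a ⟩ W′

  entrance : (S : V Γ → Set) → Star (Adj Γ) u v → S v →
             S u ⊎ (∃[ y ] ∃[ z ] Walk (¬_ ∘ S) u y × Adj Γ y z × S z)
  entrance S ε s = inj₁ s
  entrance {u = u} S (b ◅ W) s with em {S u} | entrance S W s
  ... | yes su | _                        = inj₁ su
  ... | no ¬su | inj₁ sw                  = inj₂ (_ , _ , [ ¬su ] , b , sw)
  ... | no ¬su | inj₂ (y , z , W′ , c , sz) = inj₂ (y , z , ¬su ∷⟨ b ⟩ W′ , c , sz)

  -- Linkages: pairs of disjoint walks.

  Before : (V Γ → Set) → V Γ → V Γ → V Γ → Set
  Before S v u = Walk (λ w → S w × w ≢ v) u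

  -- When the walk is cut at its first visit to `v`, every earlier vertex lies in the component of
  -- `u` in `S` without `v`.
  approach : Walk S u v → Walk (λ w → Before S v u w ⊎ w ≡ v) u v
  approach [ s ] = [ inj₂ refl ]
  approach {u = u} {v = v} (s ∷⟨ a ⟩ W) with em {u ≡ v}
  ... | yes refl = [ inj₂ refl ]
  ... | no u≢v   = inj₁ [ s , u≢v ] ∷⟨ a ⟩ map (Sum.map₁ ((s , u≢v) ∷⟨ a ⟩_)) (approach W)

  -- The walks are kept apart by two disjoint sets containing them, so that repeated vertices do no
  -- harm and the sets can be redrawn at each pivot.
  record Linkage (a b x y : V Γ) : Set₁ where
    field
      Left Right : V Γ → Set
      disjoint   : ∀ {w} → Left w → ¬ Right w
      left       : Walk Left a x
      right      : Walk Right b y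

  open Linkage

  -- The walk from y to x first meets the two linking walks (the right one
  -- stopped short of v) at some z: meeting the left one, the walk from z back to
  -- y continues it; meeting the right one, it diverts the right walk to y, while
  -- the left one is prolonged from x to v.
  pivot : Linkage a b x v → Adj Γ x v → Walk (_≢ v) y x → Linkage a b y v ⊎ Linkage a b v y
  pivot {a} {b} {x} {v} {y} l xv W
    with firstHit (λ w → Walk (Left l) a w ⊎ Before (Right l) v b w) W (inj₁ (left l))
  ... | z , inj₁ L , R = inj₁ record
    { Left     = λ w → Walk (Left l) a w ⊎ (w ≢ v × ¬ Before (Right l) v b w)
    ; Right    = λ w → Before (Right l) v b w ⊎ w ≡ v
    ; disjoint = λ
      { (inj₁ s) (inj₁ t)            → disjoint l (target s) (proj₁ (target t))
      ; (inj₁ s) (inj₂ refl)         → disjoint l (target s) (target (right l))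
      ; (inj₂ (_ , ¬t)) (inj₁ t)     → ¬t t
      ; (inj₂ (w≢v , _)) (inj₂ w≡v) → w≢v w≡v }
    ; left     = map inj₁ (reachable L) ◅◅ reverseʷ (map detour R)
    ; right    = approach (right l)
    }
    where
    detour : ∀ {w} → w ≢ v × (Walk (Left l) a w ⊎ Before (Right l) v b w → w ≡ z) →
             Walk (Left l) a w ⊎ (w ≢ v × ¬ Before (Right l) v b w)
    detour {w} (w≢v , first) with em {w ≡ z}
    ... | yes refl = inj₁ L
    ... | no w≢z   = inj₂ (w≢v , w≢z ∘ first ∘ inj₂)
  ... | z , inj₂ B , R = inj₂ record
    { Left     = λ w → Walk (Left l) a w ⊎ w ≡ v
    ; Right    = λ w → Before (Right l) v b w ⊎ (w ≢ v × ¬ Walk (Left l) a w)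
    ; disjoint = λ
      { (inj₁ s) (inj₁ t)            → disjoint l (target s) (proj₁ (target t))
      ; (inj₂ w≡v) (inj₁ t)         → proj₂ (target t) w≡v
      ; (inj₁ s) (inj₂ (_ , ¬s))     → ¬s s
      ; (inj₂ w≡v) (inj₂ (w≢v , _)) → w≢v w≡v }
    ; left     = map inj₁ (reachable (left l)) ▻⟨ xv ⟩ [ inj₂ refl ]
    ; right    = map inj₁ (reachable B) ◅◅ reverseʷ (map detour R)
    }
    where
    detour : ∀ {w} → w ≢ v × (Walk (Left l) a w ⊎ Before (Right l) v b w → w ≡ z) →
             Before (Right l) v b w ⊎ (w ≢ v × ¬ Walk (Left l) a w)
    detour {w} (w≢v , first) with em {w ≡ z}
    ... | yes refl = inj₁ B
    ... | no w≢z   = inj₂ (w≢v , w≢z ∘ first ∘ inj₁)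

  linkage-sym : Linkage a b x y → Linkage x y a b
  linkage-sym l = record
    { disjoint = disjoint l ; left = reverseʷ (left l) ; right = reverseʷ (right l) }

  linkage-flip : Linkage a b x y → Linkage b a y x
  linkage-flip l = record
    { disjoint = λ s t → disjoint l t s ; left = right l ; right = left l }

  Linked : V Γ → V Γ → V Γ → V Γ → Set₁
  Linked a b x y = Linkage a b x y ⊎ Linkage a b y x

  linked-sym : Linked a b x y → Linked x y a b
  linked-sym (inj₁ l) = inj₁ (linkage-sym l)
  linked-sym (inj₂ l) = inj₂ (linkage-flip (linkage-sym l))

  linked-pivot : Linked a b x v → Adj Γ x v → Walk (_≢ v) y x → Linked a b v y
  linked-pivot (inj₁ l) xv W = Sum.swap (pivot l xv W)
  linked-pivot (inj₂ l) xv W = Sum.map linkage-flip linkage-flip (pivot (linkage-flip l) xv W)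

  linkage-avoids : Linkage a b x y → Walk (_≢ a) b y
  linkage-avoids l = map (λ { r refl → disjoint l (source (left l)) r }) (right l)

  -- No vertex separates a lobe. The walk that starts at `b` is disjoint from the one that starts at
  -- `a`; should it end at `y`, the edge `xy` leads on to `x`, and there `x ≢ a` is used.
  linked-walk : Linked a b x y → Adj Γ x y → x ≢ a → Walk (_≢ a) b x
  linked-walk (inj₁ l) xy x≢a = linkage-avoids l ▻⟨ Graph.sym Γ xy ⟩ [ x≢a ]
  linked-walk (inj₂ l) xy x≢a = linkage-avoids l

  linked-refl : Adj Γ a b → Linked a b a b
  linked-refl {a} {b} ab = inj₁ record
    { Left = _≡ a ; Right = _≡ b
    ; disjoint = λ { refl refl → Graph.irrefl Γ refl ab } ; left = [ refl ] ; right = [ refl ] }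

  -- Path u v xs visits the vertices u ∷ xs.
  data Path : V Γ → V Γ → List (V Γ) → Set where
    []  : Path u u []
    _∷_ : Adj Γ u w → Path w v xs → Path u v (w ∷ xs)

  suffix : Path u v xs → Unique (u ∷ xs) → All S (u ∷ xs) → z ∈ u ∷ xs →
           ∃[ ys ] Path z v ys × Unique (z ∷ ys) × All S (z ∷ ys)
  suffix P uniq ss (here refl) = _ , P , uniq , ss
  suffix (_ ∷ P) (_ ∷ uniq) (_ ∷ ss) (there z∈) = suffix P uniq ss z∈

  -- Loop erasure: if `u` recurs on the simplified remainder, whatever precedes that occurrence is
  -- dropped.
  simplify : Walk S u v → ∃[ xs ] Path u v xs × Unique (u ∷ xs) × All S (u ∷ xs)
  simplify [ s ] = [] , [] , [] ∷ [] , s ∷ []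
  simplify {u = u} (_∷⟨_⟩_ {w = w} s a W) with simplify W
  ... | xs , P , uniq , ss with em {u ∈ w ∷ xs}
  ...   | yes u∈ = suffix P uniq ss u∈
  ...   | no  u∉ = w ∷ xs , a ∷ P , ¬Any⇒All¬ _ u∉ ∷ uniq , s ∷ ss

  walk : Path u v xs → Walk (_∈ u ∷ xs) u v
  walk []      = [ here refl ]
  walk (a ∷ P) = here refl ∷⟨ a ⟩ map there (walk P)

  -- Pivot at each vertex of the path in turn: its two neighbours are joined by
  -- what remains of the closed walk formed by the path, the edge pq and the walk W
  -- from v to q.
  slide : Path x p xs → Unique (x ∷ xs) → Adj Γ v x → Walk (_∉ x ∷ xs) v q → Adj Γ p q →
          Linked a b v x → Linked a b p q
  slide [] _ vx W _ l = linked-pivot l vx (reverseʷ (map (λ w∉ → w∉ ∘ here) W))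
  slide {x = x} {xs = x₁ ∷ _} (xx₁ ∷ P) (x∉ ∷ uniq) vx W pq l =
    slide P uniq xx₁ (All¬⇒¬Any x∉ ∷⟨ Graph.sym Γ vx ⟩ map (_∘ there) W) pq
      (linked-pivot l vx
        (map (λ { w∈ refl → All¬⇒¬Any x∉ w∈ }) (walk P)
         ▻⟨ pq ⟩ reverseʷ (map (λ w∉ → w∉ ∘ here) W)))

  -- The left walk of the second linkage, made a path, carries the linked edge from `yx` to the edge
  -- between `p` and `q`. The right walk joins the far ends of these edges and stays off the path by
  -- disjointness.
  linked-trans : Adj Γ x y → Adj Γ p q → Linked a b x y → Linked x y p q → Linked a b p q
  linked-trans xy pq l (inj₁ m) =
    let _ , P , uniq , ss = simplify (left m)
    in slide P uniq (Graph.sym Γ xy) (map (λ t w∈ → disjoint m (All.lookup ss w∈) t) (right m)) pq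
         (Sum.swap l)
  linked-trans xy pq l (inj₂ m) =
    let _ , P , uniq , ss = simplify (left m)
    in Sum.swap (slide P uniq (Graph.sym Γ xy)
         (map (λ t w∈ → disjoint m (All.lookup ss w∈) t) (right m)) (Graph.sym Γ pq) (Sum.swap l))

  -- From linkages to cycles.

  path-linked : Path u v xs → ∀ i → Adj Γ (lookup (u ∷ xs) (inject₁ i)) (lookup xs i)
  path-linked (a ∷ _) zero    = a
  path-linked (_ ∷ P) (suc i) = path-linked P i

  path-last : Path u v xs → lookup (u ∷ xs) (fromℕ (length xs)) ≡ v
  path-last []      = refl
  path-last (_ ∷ P) = path-last P

  join : Path a x xs → Adj Γ x y → Path y b ys → Path a b (xs ++ y ∷ ys)
  join []      xy Q = xy ∷ Q
  join (a ∷ P) xy Q = a ∷ join P xy Q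

  join-consecutive : Path a x xs → ∀ y ys → Σ[ i ∈ Fin (length (xs ++ y ∷ ys)) ]
    (lookup (a ∷ xs ++ y ∷ ys) (inject₁ i) ≡ x × lookup (xs ++ y ∷ ys) i ≡ y)
  join-consecutive []      y ys = zero , refl , refl
  join-consecutive (_ ∷ P) y ys = let i , p = join-consecutive P y ys in suc i , p

  cycle : Path a b (x ∷ y ∷ xs) → Unique (a ∷ x ∷ y ∷ xs) → Adj Γ b a → Cycle Γ
  cycle {a} {b} {x} {y} {xs} P uniq ba = record
    { excess = length xs ; vertex = vertex ; distinct = lookup-injective uniq ; linked = linked }
    where
    vertex = lookup (a ∷ x ∷ y ∷ xs)
    linked : ∀ i → Adj Γ (vertex i) (vertex (next i))
    linked i with view i
    ... | ‵fromℕ     = subst₂ (Adj Γ) (sym (path-last P)) (cong vertex (sym (next-fromℕ _))) ba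
    ... | ‵inject₁ j = subst (Adj Γ _) (cong vertex (sym (next-inject₁ j))) (path-linked P j)

  -- The edge `ab` closes the path to a cycle through each of its edges, unless the path is a single
  -- step, which is then the edge `ab` itself.
  path⇒≅ : Path a b xs → Unique (a ∷ xs) → (ab : Adj Γ a b) (i : Fin (length xs)) (xy : Adj Γ x y) →
           lookup (a ∷ xs) (inject₁ i) ≡ x → lookup xs i ≡ y → _≅_ Γ (arc a b ab) (arc x y xy)
  path⇒≅ {xs = _ ∷ []} (_ ∷ []) _ _ zero _ a≡x b≡y = inj₁ (inj₁ (a≡x , b≡y))
  path⇒≅ {a} {xs = x′ ∷ y′ ∷ xs} P uniq ab i _ xᵢ yᵢ = inj₂
    ( cycle P uniq (Graph.sym Γ ab)
    -- The closing edge of the cycle runs from `b` back to `a`, hence the reversed orientation.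
    , (fromℕ _ , inj₂ (cong (lookup (a ∷ x′ ∷ y′ ∷ xs)) (sym (next-fromℕ _)) , sym (path-last P)))
    , (inject₁ i , inj₁ (sym xᵢ , trans (sym yᵢ)
        (cong (lookup (a ∷ x′ ∷ y′ ∷ xs)) (sym (next-inject₁ i))))))

  -- The left walk, the edge `xy` and the right walk reversed make up a path from `a` to `b`, simple
  -- because the two walks are disjoint.
  linkage⇒≅ : (ab : Adj Γ a b) (xy : Adj Γ x y) → Linkage a b x y → _≅_ Γ (arc a b ab) (arc x y xy)
  linkage⇒≅ {y = y} ab xy l =
    let _ , P , P! , ss = simplify (left l)
        _ , Q , Q! , ts = simplify (reverseʷ (right l))
        i , p , q       = join-consecutive P y _
    in path⇒≅ (join P xy Q)
         (++⁺ P! Q! (λ (w∈ , w∈′) → disjoint l (All.lookup ss w∈) (All.lookup ts w∈′)))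
         ab i xy p q

  -- Agreement of linkage with the relation of lying on a common cycle.

  infix 4 _∥_

  _∥_ : Arc Γ → Arc Γ → Set₁
  e ∥ f = Linked (tail e) (head e) (tail f) (head f)

  SameEdge⇒∥ : ∀ e f → SameEdge Γ e f → e ∥ f
  SameEdge⇒∥ (arc a b ab) _ (inj₁ (refl , refl)) = linked-refl ab
  SameEdge⇒∥ (arc a b ab) _ (inj₂ (refl , refl)) = Sum.swap (linked-refl ab)

  ∥-trans : ∀ e f g → e ∥ f → f ∥ g → e ∥ g
  ∥-trans e f g = linked-trans (adjacent f) (adjacent g)

  module _ (C : Cycle Γ) where
    open Cycle C using (vertex; distinct; linked; edge)

    private
      UpTo From : Fin (Cycle.length C) → V Γ → Set
      UpTo i w = ∃[ j ] toℕ j ≤ toℕ i × vertex j ≡ w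
      From i w = ∃[ j ] toℕ i ≤ toℕ j × vertex j ≡ w

      step : ∀ i → Adj Γ (vertex (inject₁ i)) (vertex (suc i))
      step i = subst (λ j → Adj Γ (vertex (inject₁ i)) (vertex j)) (next-inject₁ i)
        (linked (inject₁ i))

      down : ∀ i → Walk (UpTo i) (vertex i) (vertex zero)
      down = <-weakInduction
        (λ i → Walk (UpTo i) (vertex i) (vertex zero))
        [ zero , ≤-refl , refl ]
        (λ i W → (suc i , ≤-refl , refl) ∷⟨ Graph.sym Γ (step i) ⟩
          map (λ (j , j≤i , p) → j ,
            ≤-trans j≤i (≤-trans (≤-reflexive (toℕ-inject₁ i)) (n≤1+n _)) , p) W)

      up : ∀ i → Walk (From i) (vertex i) (vertex (fromℕ _))
      up = >-weakInduction
        (λ i → Walk (From i) (vertex i) (vertex (fromℕ _)))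
        [ fromℕ _ , ≤-refl , refl ]
        (λ i W → (inject₁ i , ≤-refl , refl) ∷⟨ step i ⟩
          map (λ (j , i≤j , p) → j ,
            ≤-trans (≤-trans (≤-reflexive (toℕ-inject₁ i)) (n≤1+n _)) i≤j , p) W)

    -- Without edge `i` and the last edge, the cycle falls into two disjoint segments: from vertex
    -- `i` down to vertex zero, and from vertex `i + 1` up to the last vertex. Any two edges are
    -- then compared through the last one.
    edge∥last : ∀ i → edge i ∥ edge (fromℕ _)
    edge∥last i with view i
    ... | ‵fromℕ     = linked-refl (linked _)
    ... | ‵inject₁ j = inj₂ record
      { Left = UpTo (inject₁ j) ; Right = From (suc j)
      ; disjoint = λ { (k , k≤j , refl) (l , j<l , p) →
          <-irrefl refl (≤-trans j<l (≤-trans (≤-reflexive (cong toℕ (distinct p)))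
            (≤-trans k≤j (≤-reflexive (toℕ-inject₁ j))))) }
      ; left  = subst (Walk (UpTo (inject₁ j)) (vertex (inject₁ j))) 
          (cong vertex (sym (next-fromℕ _))) (down (inject₁ j))
      ; right = subst (λ k → Walk (From (suc j)) (vertex k) (vertex (fromℕ _)))
          (sym (next-inject₁ j)) (up (suc j))
      }

  ≅⇒∥ : ∀ e f → _≅_ Γ e f → e ∥ f
  ≅⇒∥ e f (inj₁ p) = SameEdge⇒∥ e f p
  ≅⇒∥ e f (inj₂ (C , (i , p) , (j , q))) = ∥-trans e last f
    (∥-trans e (edge i) last (SameEdge⇒∥ e (edge i) p) (edge∥last C i))
    (linked-sym (∥-trans f (edge j) last (SameEdge⇒∥ f (edge j) q) (edge∥last C j)))
    where
    open Cycle C using (edge)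
    last = edge (fromℕ _)

  ∥⇒≅ : ∀ e f → e ∥ f → _≅_ Γ e f
  ∥⇒≅ (arc _ _ ab) (arc _ _ xy) (inj₁ l) = linkage⇒≅ ab xy l
  ∥⇒≅ (arc _ _ ab) (arc _ _ xy) (inj₂ l) =
    reverse-≅ Γ (arc _ _ (Graph.sym Γ ab)) (arc _ _ xy)
      (linkage⇒≅ (Graph.sym Γ ab) xy (linkage-flip l))

  ≅-refl : ∀ e → _≅_ Γ e e
  ≅-refl _ = inj₁ (inj₁ (refl , refl))

  ≅-sym : ∀ e f → _≅_ Γ e f → _≅_ Γ f e
  ≅-sym _ _ (inj₁ (inj₁ (p , q))) = inj₁ (inj₁ (sym p , sym q))
  ≅-sym _ _ (inj₁ (inj₂ (p , q))) = inj₁ (inj₂ (sym q , sym p))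
  ≅-sym _ _ (inj₂ (C , p , q))    = inj₂ (C , q , p)

  ≅-trans : ∀ e f g → _≅_ Γ e f → _≅_ Γ f g → _≅_ Γ e g
  ≅-trans e f g p q = ∥⇒≅ e g (∥-trans e f g (≅⇒∥ e f p) (≅⇒∥ f g q))

-- Isomorphisms of graphs.

module _ {Γ Δ : Graph} (ψ : Γ ≃ Δ) where

  to∘from : ∀ v → to ψ (from ψ v) ≡ v
  to∘from = Inverse.strictlyInverseˡ (bijection ψ)

  from∘to : ∀ v → from ψ (to ψ v) ≡ v
  from∘to = Inverse.strictlyInverseʳ (bijection ψ)

  ≃-sym : Δ ≃ Γ
  ≃-sym = record
    { bijection = ↔-sym (bijection ψ)
    ; adj⇔adj   = λ u v → mk⇔
        (Equivalence.from (adj⇔adj ψ _ _) ∘ subst₂ (Adj Δ) (sym (to∘from u)) (sym (to∘from v)))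
        (subst₂ (Adj Δ) (to∘from u) (to∘from v) ∘ Equivalence.to (adj⇔adj ψ _ _))
    }

  mapArc : Arc Γ → Arc Δ
  mapArc (arc u v a) = arc (to ψ u) (to ψ v) (Equivalence.to (adj⇔adj ψ u v) a)

≃-trans : ∀ {Γ Δ Θ} → Γ ≃ Δ → Δ ≃ Θ → Γ ≃ Θ
≃-trans ψ χ = record
  { bijection = bijection χ ↔-∘ bijection ψ
  ; adj⇔adj   = λ u v → adj⇔adj χ _ _ ⇔-∘ adj⇔adj ψ u v
  }

-- Canonical representatives of lobes.

module Lobes (em : ExcludedMiddle 0ℓ) (Γ : Graph) (countable : Countable Γ) where

  open Walks em Γ

  private
    variable
      t u v w x y : V Γ
    code : V Γ → ℕ
    code = Injection.to countable

  leastℕ : {Q : ℕ → Set} → ∀ {n} → Acc _<_ n → Q n → ∃[ m ] Q m × (∀ k → Q k → m ≤ k)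
  leastℕ {Q} {n} (acc rs) q with em {∃[ m ] m < n × Q m}
  ... | yes (m , m<n , q′) = leastℕ (rs m<n) q′
  ... | no none = n , q , λ k qk → ≮⇒≥ (λ k<n → none (k , k<n , qk))

  Least : (V Γ → Set) → V Γ → Set
  Least S v = S v × (∀ w → S w → code v ≤ code w)

  least : {S : V Γ → Set} → ∃ S → ∃ (Least S)
  least {S} (v , s)
    with leastℕ {λ n → ∃[ w ] S w × code w ≡ n} (<-wellFounded (code v)) (v , s , refl)
  ... | _ , (w , s′ , refl) , min = w , s′ , λ x sx → min (code x) (x , sx , refl)

  -- Choices made by least code depend only on the extension of a predicate, hence only on the lobe
  -- and not on the edge presenting it.
  least-unique : {S T : V Γ → Set} → (∀ {w} → S w → T w) → (∀ {w} → T w → S w) →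
                 Least S u → Least T v → u ≡ v
  least-unique f g (s , ms) (t , mt) =
    Injection.injective countable (≤-antisym (ms _ (g t)) (mt _ (f s)))

  abstract
    leastTail : ∀ e → ∃ (Least (λ u → ∃[ v ] Σ[ a ∈ Adj Γ u v ] _≅_ Γ (arc u v a) e))
    leastTail e = least (tail e , head e , adjacent e , ≅-refl e)

    leastHead : ∀ e → ∃ (Least (λ v → Σ[ a ∈ Adj Γ (proj₁ (leastTail e)) v ] _≅_ Γ (arc _ v a) e))
    leastHead e = least (proj₁ (proj₂ (leastTail e)))

    -- Adjacency may have several proofs. Passing the proof through `recompute` makes it depend on
    -- the ends alone, so that representatives with equal ends are equal arcs.
    rep : Arc Γ → Arc Γ
    rep e = arc _ _ (recompute em (proj₁ (proj₁ (proj₂ (leastHead e)))))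

    rep-≅ : ∀ e → _≅_ Γ (rep e) e
    rep-≅ e = proj₂ (proj₁ (proj₂ (leastHead e)))

    arc-≡ : u ≡ v → x ≡ y → .(a : Adj Γ u x) .(b : Adj Γ v y) →
            arc {Γ} u x (recompute em a) ≡ arc v y (recompute em b)
    arc-≡ refl refl _ _ = refl

    edge-cong : ∀ e f → _≅_ Γ e f → u ≡ v →
                Σ[ a ∈ Adj Γ u w ] _≅_ Γ (arc u w a) e → Σ[ a ∈ Adj Γ v w ] _≅_ Γ (arc v w a) f
    edge-cong {u} {w = w} e f p refl (a , q) = a , ≅-trans (arc u w a) e f q p

    rep-cong : ∀ e f → _≅_ Γ e f → rep e ≡ rep f
    rep-cong e f p = arc-≡ tails heads _ _
      where
      p⁻¹ : _≅_ Γ f e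
      p⁻¹ = ≅-sym e f p

      tails : proj₁ (leastTail e) ≡ proj₁ (leastTail f)
      tails = least-unique
        (λ (v , q) → v , edge-cong e f p refl q)
        (λ (v , q) → v , edge-cong f e p⁻¹ refl q)
        (proj₂ (leastTail e)) (proj₂ (leastTail f))

      heads : proj₁ (leastHead e) ≡ proj₁ (leastHead f)
      heads = least-unique (edge-cong e f p tails) (edge-cong f e p⁻¹ (sym tails))
        (proj₂ (leastHead e)) (proj₂ (leastHead f))

  -- A lobe is represented by the edge of it whose ends have the least codes, so
  -- that equality of lobes is _≡_.
  Lobe : Set
  Lobe = [ e ∈ Arc Γ ∣ rep e ≡ e ]

  abstract
    class : Arc Γ → Lobe
    class e = rep e , [ rep-cong (rep e) e (rep-≅ e) ]

    class-cong : ∀ e f → _≅_ Γ e f → class e ≡ class f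
    class-cong e f p = value-injective (rep-cong e f p)

    class-injective : ∀ e f → class e ≡ class f → _≅_ Γ e f
    class-injective e f p = ≅-trans e (rep e) f (≅-sym (rep e) e (rep-≅ e))
      (subst (λ g → _≅_ Γ g f) (sym (cong value p)) (rep-≅ f))

    class-value : (L : Lobe) → class (value L) ≡ L
    class-value (e , [ p ]) = value-injective (recompute em p)

    value-class : ∀ e → _≅_ Γ (value (class e)) e
    value-class = rep-≅

  infix 4 _∈ᴸ_

  _∈ᴸ_ : V Γ → Lobe → Set
  v ∈ᴸ L = ∃[ x ] Σ[ a ∈ Adj Γ v x ] class (arc v x a) ≡ L

  ∈lobe⇒∈ᴸ : ∀ e → _∈lobe_ Γ v e → v ∈ᴸ class e
  ∈lobe⇒∈ᴸ e (arc v x a , p , inj₁ refl) = x , a , class-cong (arc v x a) e p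
  ∈lobe⇒∈ᴸ e (arc x v a , p , inj₂ refl) =
    x , Graph.sym Γ a , class-cong (arc v x (Graph.sym Γ a)) e (reverse-≅ Γ (arc x v a) e p)

  ∈ᴸ⇒∈lobe : ∀ L → v ∈ᴸ L → _∈lobe_ Γ v (value L)
  ∈ᴸ⇒∈lobe {v} L (x , a , p) =
    arc v x a , class-injective (arc v x a) (value L) (trans p (sym (class-value L))) , inj₁ refl

  tail∈ : ∀ e → tail e ∈ᴸ class e
  tail∈ e = head e , adjacent e , refl

  head∈ : ∀ e → head e ∈ᴸ class e
  head∈ e = ∈lobe⇒∈ᴸ e (e , ≅-refl e , inj₂ refl)

  At : V Γ → Set
  At v = [ L ∈ Lobe ∣ v ∈ᴸ L ]

  -- The lobes at `v` correspond to the components of the graph without `v`. Edges from `v` into one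
  -- component share a lobe: a single pivot at `v` turns one into the other.
  pivot-class : (a : Adj Γ v x) (b : Adj Γ v y) → Walk (_≢ v) y x →
                class (arc v x a) ≡ class (arc v y b)
  pivot-class {v} {x} {y} a b W = class-cong (arc v x a) (arc v y b)
    (∥⇒≅ (arc _ _ a) (arc _ _ b) (linked-pivot (Sum.swap (linked-refl a)) (Graph.sym Γ a) W))

  -- The other half of the correspondence: deleting `v` leaves the rest of each lobe at `v` inside
  -- one component.
  lobe-walk : ∀ {L} (a : Adj Γ v x) → class (arc v x a) ≡ L → t ∈ᴸ L → t ≢ v → Walk (_≢ v) x t
  lobe-walk {v} {x} {t} a p (z , b , q) t≢v = linked-walk
    (≅⇒∥ (arc v x a) (arc t z b) (class-injective (arc v x a) (arc t z b) (trans p (sym q)))) b t≢v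

  -- The tree of lobes seen from a root.

  module Rooted (connected : Connected Γ) (a : Arc Γ) where

    private
      r = tail a

    toRoot : ∀ v → v ≢ r → ∃[ x ] Adj Γ v x × Walk (_≢ v) x r
    toRoot v v≢r with entrance (_≡ v) (connected r v) refl
    ... | inj₁ r≡v                      = contradiction (sym r≡v) v≢r
    ... | inj₂ (y , z , W , c , refl) = y , Graph.sym Γ c , reverseʷ W

    -- For v ≢ r, the lobe at v through which v is joined to the root; for v ≡ r, by
    -- convention, the lobe of a, so that matching parents matches the lobes of the
    -- two given arcs.
    parent : V Γ → Lobe
    parent v with em {v ≡ r}
    ... | yes _  = class a
    ... | no v≢r = let x , b , _ = toRoot v v≢r in class (arc v x b)

    parent-root : parent r ≡ class a
    parent-root with em {r ≡ r}
    ... | yes _  = refl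
    ... | no r≢r = contradiction refl r≢r

    parent-∈ : ∀ v → v ∈ᴸ parent v
    parent-∈ v with em {v ≡ r}
    ... | yes refl = tail∈ a
    ... | no v≢r   = let x , b , _ = toRoot v v≢r in tail∈ (arc v x b)

    -- Two ways from `v` to the root meet at the root, so together they join the far ends of their
    -- first edges off `v`.
    parent-≡ : v ≢ r → (b : Adj Γ v x) → Walk (_≢ v) x r → parent v ≡ class (arc v x b)
    parent-≡ {v} v≢r b W with em {v ≡ r}
    ... | yes v≡r = contradiction v≡r v≢r
    ... | no v≢r′ = let _ , c , W′ = toRoot v v≢r′ in pivot-class c b (W ◅◅ reverseʷ W′)

    parentAt : ∀ v → At v
    parentAt v = parent v , [ parent-∈ v ]

    -- The disjunct `t ≡ r` makes the root the top of every lobe through it, including `class a`,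
    -- its conventional parent.
    IsTop : Lobe → V Γ → Set
    IsTop L t = t ∈ᴸ L × (t ≡ r ⊎ parent t ≢ L)

    top-exists : ∀ L → ∃[ t ] IsTop L t × (∀ {v} → v ∈ᴸ L → v ≢ t → v ≢ r × parent v ≡ L)
    top-exists L with em {r ∈ᴸ L}
    -- Another vertex of `L` does not separate `L`, so it is joined to the root through `L`.
    ... | yes r∈ = r , (r∈ , inj₁ refl) , λ v∈ v≢r →
      let x , b , p = v∈ in
      v≢r , trans (parent-≡ v≢r b (lobe-walk {L = L} b p r∈ (≢-sym v≢r))) p
    ... | no r∉ with entrance (_∈ᴸ L) (connected r (tail (value L)))
                       (head (value L) , adjacent (value L) , class-value L)
    ...   | inj₁ r∈ = contradiction r∈ r∉
    -- The top is the first vertex of `L` on a walk from the root; the other vertices of `L` reach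
    -- the root through it and back along that walk.
    ...   | inj₂ (y , t , W , yt , t∈) = t , (t∈ , inj₂ parent≢) , λ v∈ v≢t →
      let x , b , p = v∈
          v≢r       = λ { refl → r∉ v∈ } in
      v≢r , trans (parent-≡ v≢r b
        (lobe-walk {L = L} b p t∈ (≢-sym v≢t)
         ▻⟨ Graph.sym Γ yt ⟩ reverseʷ (map (λ { w∉ refl → w∉ v∈ }) W))) p
      where
      parent≢ : parent t ≢ L
      -- The parent of `t` contains `y`, the vertex preceding `t` on the walk, which lies outside
      -- `L`.
      parent≢ p = target W (subst (y ∈ᴸ_)
        (trans (sym (parent-≡ (λ { refl → r∉ t∈ }) (Graph.sym Γ yt)
          (reverseʷ (map (λ { w∉ refl → w∉ t∈ }) W)))) p)
        (head∈ (arc t y (Graph.sym Γ yt))))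

    -- If `t` were not the top found by `top-exists`, it would itself be below that one, against
    -- `IsTop`.
    below-top : ∀ {L} → IsTop L t → v ∈ᴸ L → v ≢ t → v ≢ r × parent v ≡ L
    below-top {t} {L = L} (t∈ , top) v∈ v≢t with top-exists L
    ... | t′ , _ , below with em {t ≡ t′}
    ...   | yes refl = below v∈ v≢t
    ...   | no t≢t′ with top | below t∈ t≢t′
    ...     | inj₁ t≡r | t≢r , _ = contradiction t≡r t≢r
    ...     | inj₂ p≢  | _ , p   = contradiction p p≢

    top-unique : ∀ {L} → IsTop L t → IsTop L u → t ≡ u
    top-unique {t} {u} p (u∈ , top) with em {u ≡ t}
    ... | yes u≡t = sym u≡t
    ... | no u≢t with top | below-top p u∈ u≢t
    ...   | inj₁ u≡r | u≢r , _ = contradiction u≡r u≢r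
    ...   | inj₂ p≢  | _ , p   = contradiction p p≢

-- Extension of a map down the tree of lobes.

module Extension (em : ExcludedMiddle 0ℓ) (Γ : Graph) (countable : Countable Γ)
                 (connected : Connected Γ) where

  open Lobes em Γ countable

  private
    variable
      s t v w x y : V Γ
      a b : Arc Γ
      L : Lobe

  lobeOf : Lobe → Graph
  lobeOf L = lobe Γ (value L)

  point : ∀ L v → .(v ∈ᴸ L) → V (lobeOf L)
  point L v v∈ = v , [ ∈ᴸ⇒∈lobe L v∈ ]

  value∈ : ∀ L (p : V (lobeOf L)) → value p ∈ᴸ L
  value∈ L (v , [ v∈ ]) = subst (v ∈ᴸ_) (class-value L) (∈lobe⇒∈ᴸ (value L) (recompute em v∈))

  at∈ : (N : At v) → v ∈ᴸ value N
  at∈ (_ , [ v∈ ]) = recompute em v∈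

  module _ (a : Arc Γ) where
    open Rooted connected a public using (parent; parentAt; IsTop)

  module R {a : Arc Γ} = Rooted connected a
  open R using (parent-root; parent-∈; top-exists; below-top; top-unique)

  -- All choices are fixed in advance, for every pair of vertices and every pair of lobes with base
  -- points, so that the data determine the map and can be inverted as a whole.
  record Transfer (a b : Arc Γ) : Set where
    field
      σ        : ∀ u w → At u ↔ At w
      σ-parent : ∀ u w → Inverse.to (σ u w) (parentAt a u) ≡ parentAt b w
      ι        : ∀ L M t s → .(t ∈ᴸ L) → .(s ∈ᴸ M) → lobeOf L ≃ lobeOf M
      ι-base   : ∀ L M t s .(t∈ : t ∈ᴸ L) .(s∈ : s ∈ᴸ M) →
                 to (ι L M t s t∈ s∈) (point L t t∈) ≡ point M s s∈

  open Transfer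

  transfer-sym : Transfer a b → Transfer b a
  transfer-sym T = record
    { σ        = λ u w → ↔-sym (σ T w u)
    ; σ-parent = λ u w → Inverse.inverseʳ (σ T w u) (sym (σ-parent T w u))
    ; ι        = λ L M t s t∈ s∈ → ≃-sym (ι T M L s t s∈ t∈)
    ; ι-base   = λ L M t s t∈ s∈ → Inverse.inverseʳ (bijection (ι T M L s t s∈ t∈))
        (sym (ι-base T M L s t s∈ t∈))
    }

  -- The graph of the extension: the root goes to the root, and a lobe with top t
  -- is mapped by ι as soon as the image of t is known.
  data Image (T : Transfer a b) : V Γ → V Γ → Set where
    root : Image T (tail a) (tail b)
    step : ∀ L M (v∈ : v ∈ᴸ L) (top : IsTop a L t) → v ≢ t → Image T t s → .(s∈ : s ∈ᴸ M) →
           Inverse.to (σ T t s) (L , [ proj₁ top ]) ≡ (M , [ s∈ ]) →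
           Image T v (value (to (ι T L M t s (proj₁ top) s∈) (point L v v∈)))

  module _ (T : Transfer a b) where

    private
      -- Both sets of indices are variables related by equations, so that matching on `refl`
      -- identifies all data depending on them; the memberships are irrelevant.
      σ-unique : ∀ {L L′ t t′ s s′ M M′} .{t∈ : t ∈ᴸ L} .{t′∈ : t′ ∈ᴸ L′}
                 .{s∈ : s ∈ᴸ M} .{s′∈ : s′ ∈ᴸ M′} →
                 L ≡ L′ → t ≡ t′ → s ≡ s′ →
                 Inverse.to (σ T t s) (L , [ t∈ ]) ≡ (M , [ s∈ ]) →
                 Inverse.to (σ T t′ s′) (L′ , [ t′∈ ]) ≡ (M′ , [ s′∈ ]) → M ≡ M′
      σ-unique refl refl refl p q = cong value (trans (sym p) q)

      ι-unique : ∀ {L L′ t t′ s s′ M M′} .{t∈ : t ∈ᴸ L} .{t′∈ : t′ ∈ᴸ L′}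
                 .{s∈ : s ∈ᴸ M} .{s′∈ : s′ ∈ᴸ M′}
                 .{v∈ : v ∈ᴸ L} .{v∈′ : v ∈ᴸ L′} →
                 L ≡ L′ → t ≡ t′ → s ≡ s′ → M ≡ M′ →
                 value (to (ι T L M t s t∈ s∈) (point L v v∈)) ≡
                 value (to (ι T L′ M′ t′ s′ t′∈ s′∈) (point L′ v v∈′))
      ι-unique refl refl refl refl = refl

    -- The last step of a derivation is forced: its lobe is the parent of the vertex, and the lobe
    -- determines its top. Induction settles the image of the top.
    image-unique : Image T v x → Image T v y → x ≡ y
    image-unique root root = refl
    image-unique root (step L M v∈ top v≢t _ _ _) =
      contradiction refl (proj₁ (below-top top v∈ v≢t))
    image-unique (step L M v∈ top v≢t _ _ _) root =
      contradiction refl (proj₁ (below-top top v∈ v≢t))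
    image-unique (step {t = t} {s = s} L M v∈ top v≢t i s∈ p)
                 (step {t = t′} {s = s′} L′ M′ v∈′ top′ v≢t′ i′ s∈′ p′) =
      ι-unique {v∈ = v∈} {v∈′ = v∈′} L≡ t≡ s≡ (σ-unique L≡ t≡ s≡ p p′)
      where
      L≡ : L ≡ L′
      L≡ = trans (sym (proj₂ (below-top top v∈ v≢t))) (proj₂ (below-top top′ v∈′ v≢t′))
      t≡ : t ≡ t′
      t≡ = top-unique top (subst (λ N → IsTop a N t′) (sym L≡) top′)
      images-≡ : t ≡ t′ → s ≡ s′
      images-≡ refl = image-unique i i′
      s≡ : s ≡ s′
      s≡ = images-≡ t≡

    -- One isomorphism describes the map on the whole lobe; at the top, which `step` excludes, it
    -- agrees with the given image by `ι-base`.
    image-lobe : IsTop a L t → Image T t s →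
                 ∃[ M ] Σ[ ψ ∈ lobeOf L ≃ lobeOf M ]
                 (∀ {v} (v∈ : v ∈ᴸ L) → Image T v (value (to ψ (point L v v∈))))
    image-lobe {L} {t} {s} top i = M , ψ , image
      where
      M  = value (Inverse.to (σ T t s) (L , [ proj₁ top ]))
      s∈ : s ∈ᴸ M
      s∈ = at∈ (Inverse.to (σ T t s) (L , [ proj₁ top ]))
      ψ  = ι T L M t s (proj₁ top) s∈
      image : ∀ {v} (v∈ : v ∈ᴸ L) → Image T v (value (to ψ (point L v v∈)))
      image {v} v∈ with em {v ≡ t}
      ... | yes refl = subst (Image T t) (sym (cong value (ι-base T L M t s v∈ s∈))) i
      ... | no v≢t   = step L M v∈ top v≢t i s∈ refl

    -- A derivation for a vertex below the top passes through the top. This lets an image spread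
    -- from any vertex of a lobe to all of it: up to the top, then down.
    image-top : IsTop a L t → v ∈ᴸ L → Image T v w → ∃ (Image T t)
    image-top {L} {t} {v} top v∈ i with em {v ≡ t}
    image-top top v∈ i | yes refl = _ , i
    image-top top v∈ root | no v≢t = contradiction refl (proj₁ (below-top top v∈ v≢t))
    image-top {t = t} top v∈ (step {t = t′} {s = s} L M v∈′ top′ v≢t′ i _ _) | no v≢t =
      s , subst (λ u → Image T u s) (top-unique (subst (λ N → IsTop a N t′) L≡ top′) top) i
      where
      L≡ = trans (sym (proj₂ (below-top top′ v∈′ v≢t′))) (proj₂ (below-top top v∈ v≢t))

    image-exists : Star (Adj Γ) v (tail a) → ∃ (Image T v)
    image-exists ε = _ , root
    image-exists {v} (_◅_ {j = w} vw W) =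
      let L           = class (arc v w vw)
          t , top , _ = top-exists L
          _ , i       = image-exists W
          _ , j       = image-top top (head∈ (arc v w vw)) i
          _ , _ , f   = image-lobe top j
      in _ , f (tail∈ (arc v w vw))

    extend : V Γ → V Γ
    extend v = proj₁ (image-exists (connected v (tail a)))

    image-extend : ∀ v → Image T v (extend v)
    image-extend v = proj₂ (image-exists (connected v (tail a)))

    -- An edge lies within a single lobe, where the map is an isomorphism of lobes.
    extend-adj : ∀ u v → Adj Γ u v → Adj Γ (extend u) (extend v)
    extend-adj u v uv =
      let e           = arc u v uv
          L           = class e
          t , top , _ = top-exists L
          M , ψ , f   = image-lobe top (image-extend t)
          adj         = Equivalence.to (adj⇔adj ψ (point L u (tail∈ e)) (point L v (head∈ e)))
                          (uv , class-injective e (value L) (sym (class-value L)))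
      in subst₂ (Adj Γ) (image-unique (f (tail∈ e)) (image-extend u))
           (image-unique (f (head∈ e)) (image-extend v)) (proj₁ adj)

    image-inverse : Image T v x → Image (transfer-sym T) x v
    image-inverse root = root
    image-inverse {v} (step {t = t} {s = s} L M v∈ top v≢t i s∈ p) =
      subst (Image (transfer-sym T) v′) (cong value (from∘to ψ (point L v v∈)))
        (step M L v′∈ (recompute em s∈ , top′ (proj₂ top)) v′≢s (image-inverse i) (proj₁ top)
          (Inverse.inverseʳ (σ T t s) (sym p)))
      where
      ψ = ι T L M t s (proj₁ top) s∈
      v′ : V Γ
      v′ = value (to ψ (point L v v∈))
      v′∈ : v′ ∈ᴸ M
      v′∈ = value∈ M (to ψ (point L v v∈))
      v′≢s : v′ ≢ s
      v′≢s v′≡s = v≢t (cong value (Injection.injective (Inverse⇒Injection (bijection ψ))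
        (trans (value-injective v′≡s) (sym (ι-base T L M t s (proj₁ top) s∈)))))
      top′ : t ≡ tail a ⊎ parent a t ≢ L → s ≡ tail b ⊎ parent b s ≢ M
      -- Roots correspond, and so do parents under `σ`; hence a lobe hanging below `t` goes to one
      -- hanging below `s`.
      top′ (inj₁ refl) = inj₁ (image-unique i root)
      top′ (inj₂ t≢)   = inj₂ λ s≡ → t≢ (cong value
        (Injection.injective (Inverse⇒Injection (σ T t s))
        (trans (σ-parent T t s) (trans (value-injective s≡) (sym p)))))

  extend-inverse : (T : Transfer a b) → ∀ v → extend (transfer-sym T) (extend T v) ≡ v
  extend-inverse T v = image-unique (transfer-sym T) (image-extend (transfer-sym T) (extend T v))
    (image-inverse T (image-extend T v))

  -- transfer-sym is not involutive up to _≡_, but extend (transfer-sym T) is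
  -- injective, having a left inverse itself.
  extend-inverse′ : (T : Transfer a b) → ∀ v → extend T (extend (transfer-sym T) v) ≡ v
  extend-inverse′ T v =
    trans (sym (extend-inverse T⁻¹ (extend T (extend T⁻¹ v))))
      (trans (cong (extend (transfer-sym T⁻¹)) (extend-inverse T (extend T⁻¹ v)))
        (extend-inverse T⁻¹ v))
    where
    T⁻¹ = transfer-sym T

  automorphism : Transfer a b → Automorphism Γ
  automorphism T = record
    { bijection = mk↔ₛ′ (extend T) (extend (transfer-sym T)) (extend-inverse′ T) (extend-inverse T)
    ; adj⇔adj   = λ u v → mk⇔ (extend-adj T u v)
        (subst₂ (Adj Γ) (extend-inverse T u) (extend-inverse T v) ∘ extend-adj (transfer-sym T) _ _)
    }

  extend-root : (T : Transfer a b) → extend T (tail a) ≡ tail b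
  extend-root {a} T = image-unique T (image-extend T (tail a)) root

  -- The root is the top of `class a`, and `σ` sends `class a` to `class b` because these are the
  -- parents of the two roots; one step from the root then gives the image.
  extend-head : (T : Transfer a b) →
    value (to (ι T (class a) (class b) (tail a) (tail b) (tail∈ a) (tail∈ b))
              (point (class a) (head a) (head∈ a))) ≡ head b →
    extend T (head a) ≡ head b
  extend-head {a} {b} T p = trans
    (image-unique T (image-extend T (head a))
      (step (class a) (class b) (head∈ a) (tail∈ a , inj₁ refl)
        (λ { q → Graph.irrefl Γ (sym q) (adjacent a) })
        root (tail∈ b) classes))
    p
    where
    classes : Inverse.to (σ T (tail a) (tail b)) (class a , [ tail∈ a ]) ≡ (class b , [ tail∈ b ])
    classes = trans (cong (Inverse.to (σ T _ _)) (value-injective (sym parent-root)))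
      (trans (σ-parent T _ _) (value-injective parent-root))

-- Action of isomorphisms on cycles.

module _ {Γ Δ : Graph} (φ : Γ ≃ Δ) where

  map-SameEdge : ∀ e f → SameEdge Γ e f → SameEdge Δ (mapArc φ e) (mapArc φ f)
  map-SameEdge _ _ (inj₁ (p , q)) = inj₁ (cong (to φ) p , cong (to φ) q)
  map-SameEdge _ _ (inj₂ (p , q)) = inj₂ (cong (to φ) p , cong (to φ) q)

  mapCycle : Cycle Γ → Cycle Δ
  mapCycle C = record
    { excess   = excess
    ; vertex   = to φ ∘ vertex
    ; distinct = distinct ∘ Injection.injective (Inverse⇒Injection (bijection φ))
    ; linked   = λ i → Equivalence.to (adj⇔adj φ _ _) (linked i)
    }
    where open Cycle C

  map-≅ : ∀ e f → _≅_ Γ e f → _≅_ Δ (mapArc φ e) (mapArc φ f)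
  map-≅ e f (inj₁ p) = inj₁ (map-SameEdge e f p)
  map-≅ e f (inj₂ (C , (i , p) , (j , q))) = inj₂
    (mapCycle C , (i , map-SameEdge e (Cycle.edge C i) p) , (j , map-SameEdge f (Cycle.edge C j) q))

  map-inverse : ∀ e → _≅_ Γ (mapArc (≃-sym φ) (mapArc φ e)) e
  map-inverse e = inj₁ (inj₁ (from∘to φ _ , from∘to φ _))

  map-inverse′ : ∀ e → _≅_ Δ (mapArc φ (mapArc (≃-sym φ) e)) e
  map-inverse′ e = inj₁ (inj₁ (to∘from φ _ , to∘from φ _))

-- Necessity of the three conditions.

module Automorphisms (em : ExcludedMiddle 0ℓ) (Γ : Graph) where

  open Walks em Γ using (≅-refl; ≅-sym; ≅-trans)

  SameLobe⇒≅ : ∀ e f → SameLobe Γ e f → _≅_ Γ e f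
  SameLobe⇒≅ e f s = Equivalence.to (s e) (≅-refl e)

  ≅⇒SameLobe : ∀ e f → _≅_ Γ e f → SameLobe Γ e f
  ≅⇒SameLobe e f p g = mk⇔ (λ q → ≅-trans g e f q p) (λ q → ≅-trans g f e q (≅-sym e f p))

  map-∈lobe : ∀ (φ : Automorphism Γ) {v} e f → _≅_ Γ (mapArc φ e) f →
              _∈lobe_ Γ v e → _∈lobe_ Γ (to φ v) f
  map-∈lobe φ e f p (g , q , i) =
    mapArc φ g , ≅-trans (mapArc φ g) (mapArc φ e) f (map-≅ φ g e q) p ,
    Sum.map (cong (to φ)) (cong (to φ)) i

  map-≅-sym : ∀ (φ : Automorphism Γ) e f → _≅_ Γ (mapArc φ e) f → _≅_ Γ (mapArc (≃-sym φ) f) e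
  map-≅-sym φ e f p = ≅-trans (mapArc φ⁻¹ f) (mapArc φ⁻¹ (mapArc φ e)) e
    (map-≅ φ⁻¹ f (mapArc φ e) (≅-sym (mapArc φ e) f p)) (map-inverse φ e)
    where
    φ⁻¹ = ≃-sym φ

  restrict : ∀ (φ : Automorphism Γ) e f → _≅_ Γ (mapArc φ e) f → lobe Γ e ≃ lobe Γ f
  restrict φ e f p = record
    { bijection = mk↔ₛ′
        (Refinement.map (to φ) (map-∈lobe φ e f p))
        (Refinement.map (from φ) (map-∈lobe φ⁻¹ f e p⁻¹))
        (λ v → value-injective (to∘from φ (value v)))
        (λ v → value-injective (from∘to φ (value v)))
    ; adj⇔adj   = λ u v → mk⇔
        (λ (a , q) → let g = arc (value u) (value v) a in
          adjacent (mapArc φ g) , ≅-trans (mapArc φ g) (mapArc φ e) f (map-≅ φ g e q) p)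
        (λ (a , q) → let g = arc (to φ (value u)) (to φ (value v)) a
                         h = arc (value u) (value v) (Equivalence.from (adj⇔adj φ _ _) a) in
          adjacent h , ≅-trans h (mapArc φ⁻¹ g) e
            (inj₁ (inj₁ (sym (from∘to φ _) , sym (from∘to φ _))))
            (≅-trans (mapArc φ⁻¹ g) (mapArc φ⁻¹ f) e (map-≅ φ⁻¹ g f q) p⁻¹))
    }
    where
    φ⁻¹ = ≃-sym φ
    p⁻¹ : _≅_ Γ (mapArc φ⁻¹ f) e
    p⁻¹ = map-≅-sym φ e f p

  sameNumberOfLobes : ∀ (φ : Automorphism Γ) v → SameNumberOfLobes Γ v (to φ v)
  sameNumberOfLobes φ v = record
    { to        = λ (e , v∈) → mapArc φ e , map-∈lobe φ e (mapArc φ e) (≅-refl (mapArc φ e)) v∈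
    ; from      = λ (e , v∈) → mapArc φ⁻¹ e ,
        subst (λ u → _∈lobe_ Γ u (mapArc φ⁻¹ e)) (from∘to φ v)
          (map-∈lobe φ⁻¹ e (mapArc φ⁻¹ e) (≅-refl (mapArc φ⁻¹ e)) v∈)
    ; to-cong   = λ {(e , _)} {(f , _)} s → map-SameLobe φ e f s
    ; from-cong = λ {(e , _)} {(f , _)} s → map-SameLobe φ⁻¹ e f s
    ; inverse   =
        (λ {(e , _)} {(f , _)} s → ≅⇒SameLobe (mapArc φ f) e
          (≅-trans (mapArc φ f) (mapArc φ (mapArc φ⁻¹ e)) e
            (map-≅ φ f (mapArc φ⁻¹ e) (SameLobe⇒≅ f (mapArc φ⁻¹ e) s)) (map-inverse′ φ e)))
      , (λ {(e , _)} {(f , _)} s → ≅⇒SameLobe (mapArc φ⁻¹ f) e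
          (≅-trans (mapArc φ⁻¹ f) (mapArc φ⁻¹ (mapArc φ e)) e
            (map-≅ φ⁻¹ f (mapArc φ e) (SameLobe⇒≅ f (mapArc φ e) s)) (map-inverse φ e)))
    }
    where
    φ⁻¹ = ≃-sym φ
    map-SameLobe : ∀ (ψ : Automorphism Γ) e f → SameLobe Γ e f →
                   SameLobe Γ (mapArc ψ e) (mapArc ψ f)
    map-SameLobe ψ e f s = ≅⇒SameLobe (mapArc ψ e) (mapArc ψ f) (map-≅ ψ e f (SameLobe⇒≅ e f s))

  module _ (transitive : ArcTransitive Γ) where

    lobe-≃ : ∀ e f → lobe Γ e ≃ lobe Γ f
    lobe-≃ e f = let φ , p , q = transitive e f in restrict φ e f (inj₁ (inj₁ (p , q)))

    underlying : ∀ {e} → Arc (lobe Γ e) → Arc Γ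
    underlying (arc u v (a , _)) = arc (value u) (value v) a

    -- An automorphism of the graph that takes one edge of the lobe into the lobe preserves the
    -- lobe, and so restricts to it.
    lobe-arcTransitive : ∀ e → ArcTransitive (lobe Γ e)
    lobe-arcTransitive e α β =
      let φ , p , q = transitive a b
      in restrict φ e e
           (≅-trans (mapArc φ e) (mapArc φ a) e (map-≅ φ e a (≅-sym a e (proj₂ (adjacent α))))
             (≅-trans (mapArc φ a) b e (inj₁ (inj₁ (p , q))) (proj₂ (adjacent β))))
         , value-injective p , value-injective q
      where
      a b : Arc Γ
      a = underlying α
      b = underlying β

    -- Every vertex is the tail of an arc, so arc-transitivity moves any vertex to any other.
    arcs⇒sameNumberOfLobes : (∀ v → ∃ (Adj Γ v)) → ∀ u v → SameNumberOfLobes Γ u v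
    arcs⇒sameNumberOfLobes neighbour u v =
      let x , a     = neighbour u
          y , b     = neighbour v
          φ , p , _ = transitive (arc u x a) (arc v y b)
      in subst (SameNumberOfLobes Γ u) p (sameNumberOfLobes φ u)

-- Excludes the graph with a single vertex; by connectedness every vertex then has a neighbour.
connectivityOne⇒arc : (Γ : Graph) → ConnectivityOne Γ → Arc Γ
connectivityOne⇒arc Γ (_ , inj₁ φ) = arc (from φ zero) (from φ (suc zero))
  (adjacent (mapArc (≃-sym φ) (arc zero (suc zero) λ ())))
connectivityOne⇒arc Γ (_ , inj₂ (_ , (e , _) , _)) = e

neighbour : (Γ : Graph) → Connected Γ → Arc Γ → ∀ v → ∃ (Adj Γ v)
neighbour Γ connected a v with connected v (tail a)
... | ε     = head a , adjacent a
... | b ◅ _ = _ , b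

-- Corrects an arbitrary bijection between the lobes at two vertices so that it matches their
-- parents.
transposition : ExcludedMiddle 0ℓ → {A : Set} (x y : A) → Σ[ π ∈ A ↔ A ] Inverse.to π x ≡ y
transposition em {A} x y = mk↔ₛ′ swap swap swap-involutive swap-involutive , swap-x
  where
  swap : A → A
  swap z with em {z ≡ x} | em {z ≡ y}
  ... | yes _ | _     = y
  ... | no _  | yes _ = x
  ... | no _  | no _  = z

  swap-x : swap x ≡ y
  swap-x with em {x ≡ x} | em {x ≡ y}
  ... | yes _  | _ = refl
  ... | no x≢x | _ = contradiction refl x≢x

  swap-y : swap y ≡ x
  swap-y with em {y ≡ x} | em {y ≡ y}
  ... | yes y≡x | _      = y≡x
  ... | no _    | yes _  = refl
  ... | no _    | no y≢y = contradiction refl y≢y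

  swap-involutive : ∀ z → swap (swap z) ≡ z
  swap-involutive z with em {z ≡ x} in p | em {z ≡ y} in q
  ... | yes refl | _        = swap-y
  ... | no _     | yes refl = swap-x
  ... | no z≢x   | no z≢y   rewrite p | q = refl

-- Sufficiency: transfer data from the three conditions.

module Converse (em : ExcludedMiddle 0ℓ) (Γ : Graph) (countable : Countable Γ)
                (connected : Connected Γ)
                (lobe-transitive : ∀ e → ArcTransitive (lobe Γ e))
                (lobe-≃ : ∀ e f → lobe Γ e ≃ lobe Γ f)
                (lobes-at : ∀ u v → SameNumberOfLobes Γ u v) where

  open Lobes em Γ countable
  open Extension em Γ countable connected
  open Automorphisms em Γ using (SameLobe⇒≅; ≅⇒SameLobe)

  at-map : ∀ {u v} → SameNumberOfLobes Γ u v → At u → At v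
  at-map i (L , [ u∈ ]) =
    let e , v∈ = Inverse.to i (value L , ∈ᴸ⇒∈lobe L (recompute em u∈))
    in class e , [ ∈lobe⇒∈ᴸ e v∈ ]

  -- The given bijection is inverted only up to `SameLobe`. Replacing `e` by `value (class e)` stays
  -- within the lobe, and `class` turns the result into an equality.
  at-map-inverse : ∀ {u v} (i : SameNumberOfLobes Γ u v) → ∀ N →
                   at-map (Symmetry.inverse i) (at-map i N) ≡ N
  at-map-inverse i (L , [ u∈ ]) = value-injective (trans
    (class-cong g (value L) (SameLobe⇒≅ g (value L)
      (Inverse.inverseʳ i (≅⇒SameLobe (value (class e)) e (value-class e)))))
    (class-value L))
    where
    l = Inverse.to i (value L , ∈ᴸ⇒∈lobe L (recompute em u∈))
    e = proj₁ l
    g : Arc Γ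
    g = proj₁ (Inverse.from i (value (class e) ,
      ∈ᴸ⇒∈lobe (class e) (recompute em (∈lobe⇒∈ᴸ e (proj₂ l)))))

  at-↔ : ∀ u v → At u ↔ At v
  at-↔ u v = mk↔ₛ′ (at-map i) (at-map (Symmetry.inverse i))
    (at-map-inverse (Symmetry.inverse i)) (at-map-inverse i)
    where
    i = lobes-at u v

  -- An edge of L at t, the edge of a being preferred: then the isomorphism from
  -- the lobe of a to that of b below also respects the heads of a and b.
  edgeAt : (a : Arc Γ) → ∀ L t → .(t ∈ᴸ L) → ∃[ x ] Σ[ c ∈ Adj Γ t x ] class (arc t x c) ≡ L
  edgeAt a L t t∈ with em {Σ[ c ∈ Adj Γ t (head a) ] class (arc t (head a) c) ≡ L}
  ... | yes c = head a , c
  ... | no _  = recompute em t∈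

  edgeAt-class : (a : Arc Γ) → proj₁ (edgeAt a (class a) (tail a) (tail∈ a)) ≡ head a
  edgeAt-class a
    with em {Σ[ c ∈ Adj Γ (tail a) (head a) ] class (arc (tail a) (head a) c) ≡ class a}
  ... | yes _   = refl
  ... | no none = contradiction (adjacent a , refl) none

  arcAt : (a : Arc Γ) → ∀ L t → .(t ∈ᴸ L) → Arc (lobeOf L)
  arcAt a L t t∈ =
    let x , c , p = edgeAt a L t t∈ in
    arc (point L t t∈) (point L x (subst (x ∈ᴸ_) p (head∈ (arc t x c))))
      (c , class-injective (arc t x c) (value L) (trans p (sym (class-value L))))

  module _ (a b : Arc Γ) where

    -- An arbitrary isomorphism of the lobes is followed by an automorphism of the target lobe that
    -- brings the chosen arcs together.
    mapping : ∀ L M t s .(t∈ : t ∈ᴸ L) .(s∈ : s ∈ᴸ M) → Σ[ ψ ∈ lobeOf L ≃ lobeOf M ]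
      (to ψ (tail (arcAt a L t t∈)) ≡ tail (arcAt b M s s∈)
      × to ψ (head (arcAt a L t t∈)) ≡ head (arcAt b M s s∈))
    mapping L M t s t∈ s∈ =
      let ψ = lobe-≃ (value L) (value M)
          χ , p , q = lobe-transitive (value M) (mapArc ψ (arcAt a L t t∈)) (arcAt b M s s∈)
      in ≃-trans ψ χ , p , q

    transfer : Transfer a b
    transfer = record
      { σ        = λ u w → proj₁ (realign u w) ↔-∘ at-↔ u w
      ; σ-parent = λ u w → proj₂ (realign u w)
      ; ι        = λ L M t s t∈ s∈ → proj₁ (mapping L M t s t∈ s∈)
      ; ι-base   = λ L M t s t∈ s∈ → proj₁ (proj₂ (mapping L M t s t∈ s∈))
      }
      where
      realign : ∀ u w → Σ[ π ∈ At w ↔ At w ]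
        Inverse.to π (Inverse.to (at-↔ u w) (parentAt a u)) ≡ parentAt b w
      realign u w = transposition em (Inverse.to (at-↔ u w) (parentAt a u)) (parentAt b w)

    transfer-head :
      value (to (Transfer.ι transfer (class a) (class b) (tail a) (tail b) (tail∈ a) (tail∈ b))
                (point (class a) (head a) (head∈ a))) ≡ head b
    transfer-head =
      let ψ , _ , p = mapping (class a) (class b) (tail a) (tail b) (tail∈ a) (tail∈ b)
      in trans (cong (value ∘ to ψ) (value-injective (sym (edgeAt-class a))))
           (trans (cong value p) (edgeAt-class b))

  arcTransitive : ArcTransitive Γ
  arcTransitive a b = automorphism T , extend-root T , extend-head T (transfer-head a b)
    where
    T = transfer a b

theorem5p1 : ExcludedMiddle 0ℓ →
    (Γ : Graph) → Countable Γ → ConnectivityOne Γ →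
    ArcTransitive Γ ⇔
    ( (∀ e → ArcTransitive (lobe Γ e))
    × (∀ e f → lobe Γ e ≃ lobe Γ f)
    × (∀ u v → SameNumberOfLobes Γ u v) )
theorem5p1 em Γ countable conn@(connected , _) = mk⇔
  (λ transitive → lobe-arcTransitive transitive , lobe-≃ transitive
    , arcs⇒sameNumberOfLobes transitive (neighbour Γ connected (connectivityOne⇒arc Γ conn)))
  (λ (p , q , r) → Converse.arcTransitive em Γ countable connected p q r)
  where open Automorphisms em Γ
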